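{- Let $A=\{a_1,a_2,\dots,a_k\}$ be a set of $k$ distinct positive integers with $\gcd(a_1,\dots,a_k)=1$. Then, as $n\to\infty$, $$N^p_A(n)\sim\frac{1}{k!}\,\frac{\frac{1}{a_1}+\frac{1}{a_2}+\cdots+\frac{1}{a_k}}{a_1a_2\cdots a_k}\,n^k.$$
   Context: $N^p_A(n)$ is the total number of parts, summed over all partitions of $n$ (unordered sequences of positive integers summing to $n$) with all parts in $A$. -}

module Defs where

open import Data.Empty using (⊥-elim)
open import Data.Fin.Base using (Fin; zero; suc)
open import Data.Integer.Base using (+_)
open import Data.List.Base using (List; []; _∷_; map; _++_; filter; length)
open import Data.List.Membership.Propositional using (_∈_)
open import Data.List.Membership.Propositional.Properties
  using (∈-map⁺; ∈-map⁻; ∈-++⁺ˡ; ∈-++⁺ʳ; ∈-++⁻; ∈-filter⁺; ∈-filter⁻)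
open import Data.List.Relation.Unary.All using (All; []; _∷_; all?)
import Data.List.Relation.Unary.All as All
open import Data.List.Relation.Unary.AllPairs using ([]; _∷_)
open import Data.List.Relation.Unary.Any using (here)
open import Data.List.Relation.Unary.Linked using (Linked; []; [-]; _∷_; linked?)
import Data.List.Relation.Unary.Linked as Linked
open import Data.List.Relation.Unary.Unique.Propositional using (Unique)
open import Data.List.Relation.Unary.Unique.Propositional.Properties
  using (map⁺; ++⁺; filter⁺)
open import Data.List.Properties using (∷-injectiveʳ)
open import Data.Nat.Base as ℕ using (ℕ; zero; suc; z≤n; s≤s)
open import Data.Nat.GCD using (gcd)
open import Data.Nat.ListAction using (sum)
import Data.Nat.Properties as ℕ
open import Data.Product.Base using (Σ-syntax; ∃-syntax; _×_; _,_; proj₁; proj₂)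
open import Data.Rational.Base as ℚ using (ℚ; 0ℚ; 1ℚ; _/_; _÷_; ∣_∣)
import Data.Rational.Properties as ℚ
open import Data.Sum.Base using (inj₁; inj₂)
open import Data.Vec.Functional using (Vector; foldr; head; tail)
import Data.Vec.Functional.Relation.Unary.Any as Vector
open import Function.Base using (_∘_)
open import Function.Bundles using (_⇔_; mk⇔)
open import Level using (0ℓ)
open import Relation.Binary.PropositionalEquality using (_≡_; refl; subst)
open import Relation.Nullary.Decidable using (yes; no; map′; _×-dec_)
open import Relation.Unary using (Pred; Decidable)

------------------------------------------------------------------------
-- Partitions

-- An unordered sequence of positive integers is represented by its unique
-- weakly decreasing arrangement.
record IsPartition (A : Pred ℕ 0ℓ) (n : ℕ) (p : List ℕ) : Set where
  constructor isPartition
  field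
    decreasing : Linked ℕ._≥_ p
    positive   : All (0 ℕ.<_) p
    sums       : sum p ≡ n
    partsIn    : All A p

isPartition? : ∀ {A} → Decidable A → ∀ n → Decidable (IsPartition A n)
isPartition? A? n p = map′
  (λ (d , q , s , m) → isPartition d q s m)
  (λ (isPartition d q s m) → d , q , s , m)
  (linked? ℕ._≥?_ p ×-dec all? (0 ℕ.<?_) p ×-dec sum p ℕ.≟ n ×-dec all? A? p)

-- All weakly decreasing lists of at most l positive integers, each at most m.
decreasingLists : (m l : ℕ) → List (List ℕ)
decreasingLists m       zero    = [] ∷ []
decreasingLists zero    (suc l) = [] ∷ []
decreasingLists (suc m) (suc l) =
  map (suc m ∷_) (decreasingLists (suc m) l) ++ decreasingLists m (suc l)

-- A partition of n has at most n parts, each at most n, so filtering this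
-- finite list loses nothing; see ∈-partitions and partitions-unique.
partitions : ∀ {A} → Decidable A → ℕ → List (List ℕ)
partitions A? n = filter (isPartition? A? n) (decreasingLists n n)

Nᵖ : ∀ {A} → Decidable A → ℕ → ℕ
Nᵖ A? n = sum (map length (partitions A? n))

private
  ∈-decreasingLists⁺ : ∀ m l {p} → Linked ℕ._≥_ p → All (0 ℕ.<_) p →
                       All (ℕ._≤ m) p → length p ℕ.≤ l → p ∈ decreasingLists m l
  ∈-decreasingLists⁺ m zero {[]} _ _ _ _ = here refl
  ∈-decreasingLists⁺ zero (suc l) {[]} _ _ _ _ = here refl
  ∈-decreasingLists⁺ zero (suc l) {x ∷ p} _ (0<x ∷ _) (x≤0 ∷ _) _ =
    ⊥-elim (ℕ.<⇒≱ 0<x x≤0)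
  ∈-decreasingLists⁺ (suc m) (suc l) {[]} d q b _ =
    ∈-++⁺ʳ _ (∈-decreasingLists⁺ m (suc l) d q [] z≤n)
  ∈-decreasingLists⁺ (suc m) (suc l) {x ∷ p} d q@(_ ∷ q′) (x≤ ∷ b) (s≤s len)
    with x ℕ.≟ suc m
  ... | yes refl = ∈-++⁺ˡ (∈-map⁺ _
          (∈-decreasingLists⁺ (suc m) l (Linked.tail d) q′ b len))
  ... | no x≢ = ∈-++⁺ʳ _ (∈-decreasingLists⁺ m (suc l) d q
          (below (ℕ.≤-pred (ℕ.≤∧≢⇒< x≤ x≢)) d) (s≤s len))
    where
    below : ∀ {x p} → x ℕ.≤ m → Linked ℕ._≥_ (x ∷ p) → All (ℕ._≤ m) (x ∷ p)
    below x≤m [-]       = x≤m ∷ []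
    below x≤m (x≥y ∷ d) = x≤m ∷ below (ℕ.≤-trans x≥y x≤m) d

  decreasingLists-bounded : ∀ m l {p} → p ∈ decreasingLists m l → All (ℕ._≤ m) p
  decreasingLists-bounded m zero (here refl) = []
  decreasingLists-bounded zero (suc l) (here refl) = []
  decreasingLists-bounded (suc m) (suc l) p∈
    with ∈-++⁻ (map (suc m ∷_) (decreasingLists (suc m) l)) p∈
  ... | inj₂ p∈′ = All.map ℕ.m≤n⇒m≤1+n (decreasingLists-bounded m (suc l) p∈′)
  ... | inj₁ p∈′ with ∈-map⁻ (suc m ∷_) p∈′
  ...   | _ , q∈ , refl = ℕ.≤-refl ∷ decreasingLists-bounded (suc m) l q∈

  decreasingLists-unique : ∀ m l → Unique (decreasingLists m l)
  decreasingLists-unique m       zero    = [] ∷ []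
  decreasingLists-unique zero    (suc l) = [] ∷ []
  decreasingLists-unique (suc m) (suc l) = ++⁺
    (map⁺ ∷-injectiveʳ (decreasingLists-unique (suc m) l))
    (decreasingLists-unique m (suc l))
    λ (p∈ , p∈′) → disjoint p∈ p∈′
    where
    disjoint : ∀ {p} {X : Set} → p ∈ map (suc m ∷_) (decreasingLists (suc m) l) →
               p ∈ decreasingLists m (suc l) → X
    disjoint p∈ p∈′ with ∈-map⁻ (suc m ∷_) p∈
    ... | _ , _ , refl =
      ⊥-elim (ℕ.1+n≰n (All.head (decreasingLists-bounded m (suc l) p∈′)))

  parts≤sum : ∀ p → All (ℕ._≤ sum p) p
  parts≤sum []      = []
  parts≤sum (x ∷ p) =
    ℕ.m≤m+n x _ ∷ All.map (λ y≤ → ℕ.≤-trans y≤ (ℕ.m≤n+m _ x)) (parts≤sum p)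

  length≤sum : ∀ {p} → All (0 ℕ.<_) p → length p ℕ.≤ sum p
  length≤sum []        = z≤n
  length≤sum (0<x ∷ q) = ℕ.+-mono-≤ 0<x (length≤sum q)

∈-partitions : ∀ {A} (A? : Decidable A) n p → p ∈ partitions A? n ⇔ IsPartition A n p
∈-partitions A? n p = mk⇔
  (λ p∈ → proj₂ (∈-filter⁻ (isPartition? A? n) {xs = decreasingLists n n} p∈))
  λ where
    P@(isPartition d q refl _) → ∈-filter⁺ (isPartition? A? n)
      (∈-decreasingLists⁺ n n d q (parts≤sum p) (length≤sum q)) P

partitions-unique : ∀ {A} (A? : Decidable A) n → Unique (partitions A? n)
partitions-unique A? n = filter⁺ (isPartition? A? n) (decreasingLists-unique n n)

------------------------------------------------------------------------
-- The set {a₁, …, aₖ}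

⟦_⟧ : ∀ {k} → Vector ℕ k → Pred ℕ 0ℓ
⟦ a ⟧ x = Vector.Any (_≡ x) a

⟦_⟧? : ∀ {k} (a : Vector ℕ k) → Decidable ⟦ a ⟧
⟦ a ⟧? x = Vector.any (ℕ._≟ x) a

gcds : ∀ {k} → Vector ℕ k → ℕ
gcds = foldr gcd 0

∏ : ∀ {k} → Vector ℕ k → ℕ
∏ = foldr ℕ._*_ 1

∑ : ∀ {k} → Vector ℚ k → ℚ
∑ = foldr ℚ._+_ 0ℚ

∏-nonZero : ∀ {k} (a : Vector ℕ k) → (∀ i → ℕ.NonZero (a i)) → ℕ.NonZero (∏ a)
∏-nonZero {zero}  a a≢0 = _
∏-nonZero {suc k} a a≢0 =
  ℕ.m*n≢0 (head a) (∏ (tail a)) {{a≢0 zero}} {{∏-nonZero (tail a) (a≢0 ∘ suc)}}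

------------------------------------------------------------------------
-- Rationals and asymptotic equivalence

fromℕ : ℕ → ℚ
fromℕ n = + n / 1

1/ℕ : (n : ℕ) → .(ℕ.NonZero n) → ℚ
1/ℕ n n≢0 = (+ 1 / n) {{n≢0}}

fromℕ-nonZero : ∀ n → ℕ.NonZero n → ℚ.NonZero (fromℕ n)
fromℕ-nonZero n n≢0 =
  ℚ.pos⇒nonZero (fromℕ n) {{ℚ.normalize-pos n 1 {{_}} {{n≢0}}}}

infixl 7 _÷ℕ_[_]

_÷ℕ_[_] : ℚ → (n : ℕ) → ℕ.NonZero n → ℚ
q ÷ℕ n [ n≢0 ] = (q ÷ fromℕ n) {{fromℕ-nonZero n n≢0}}

-- f n / g n → 1 as n → ∞; the quotient need only be defined eventually.
infix 4 _∼_

_∼_ : (f g : ℕ → ℚ) → Set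
f ∼ g = ∀ (ε : ℚ) → 0ℚ ℚ.< ε → ∃[ N ] ∀ n → N ℕ.≤ n →
  Σ[ gn≢0 ∈ ℚ.NonZero (g n) ] ∣ (f n ÷ g n) {{gn≢0}} ℚ.- 1ℚ ∣ ℚ.< ε

{-# OPTIONS --safe #-}

-- Counting the parts equal to c one after the other, Nᵖ(n) is the sum over c ∈ A of the
-- coefficients of x^c/(1 - x^c) · ∏_{a ∈ A} 1/(1 - x^a), so it suffices to estimate the number
-- P(n) of partitions of n into parts from a multiset L of size d + 2 with gcd 1.  Since P(n) and
-- P(n - a) differ by the number of partitions into parts from L ∖ {a}, they agree up to O(n^d) for
-- every a ∈ L; by Bézout so do P(n) and P(n - 1).  As (1 - x^a)/(1 - x) = 1 + x + … + x^(a - 1), it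
-- follows that replacing the part a by 1 multiplies P by a, up to O(n^d).  Once all parts are 1,
-- P(n) is (n + 1)(n + 2)…(n + d + 1)/(d + 1)!.

module Submission where

open import Defs
open import Data.Empty using (⊥; ⊥-elim)
open import Data.Fin.Base using (Fin; zero; suc)
open import Data.List.Base using (List; []; _∷_; _++_; foldr; length; map; replicate; tabulate)
open import Data.List.Membership.Propositional using (_∈_)
open import Data.List.Membership.Propositional.Properties
  using (∈-++⁺ˡ; ∈-++⁺ʳ; ∈-++⁻; ∈-map⁺; ∈-map⁻; ∈-tabulate⁺; ∈-tabulate⁻; ∈-∃++)
open import Data.List.Membership.Propositional.Properties.WithK using (unique∧set⇒bag)
open import Data.List.Properties
  using (++-identityʳ; length-++; length-map; length-replicate; length-tabulate; map-++; map-tabulate; ∷-injectiveʳ)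
open import Data.List.Relation.Binary.BagAndSetEquality using (∼bag⇒↭)
open import Data.List.Relation.Binary.Permutation.Propositional as Perm using (_↭_; ↭-sym; ↭⇒↭ₛ)
import Data.List.Relation.Binary.Permutation.Propositional.Properties as ↭
import Data.List.Relation.Binary.Permutation.Setoid.Properties as ↭ₛ
open import Data.List.Relation.Unary.All as All using (All; []; _∷_)
import Data.List.Relation.Unary.All.Properties as All
open import Data.List.Relation.Unary.AllPairs as AllPairs using (AllPairs; []; _∷_)
open import Data.List.Relation.Unary.Any using (here; there)
open import Data.List.Relation.Unary.Linked as Linked using (Linked; []; [-]; _∷_)
open import Data.List.Relation.Unary.Linked.Properties using (Linked⇒AllPairs)
open import Data.List.Relation.Unary.Unique.Propositional using (Unique)
import Data.List.Relation.Unary.Unique.Propositional.Properties as Unique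
open import Data.Nat.Base as ℕ using (ℕ; zero; suc; z≤n; s≤s; NonZero)
open import Data.Nat.GCD using (gcd)
open import Data.Nat.ListAction using (sum; product)
open import Data.Nat.ListAction.Properties using (sum-++; sum-↭)
import Data.Nat.Properties as ℕ
open import Data.Product.Base using (∃-syntax; Σ-syntax; _×_; _,_; proj₁; proj₂)
open import Data.Sum.Base using (_⊎_; inj₁; inj₂)
open import Data.Vec.Functional using (Vector)
open import Function.Base using (_∘_; _$_)
open import Function.Bundles using (Equivalence; mk⇔)
open import Level using (0ℓ)
import Relation.Binary.Construct.Flip.EqAndOrd as Flip
open import Relation.Binary.PropositionalEquality
  using (_≡_; _≗_; cong; cong₂; refl; setoid; subst; subst₂; sym; trans; module ≡-Reasoning)
open import Relation.Unary using (Pred; Decidable)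

module PartitionCounts where

  open import Data.Nat.Base
  open import Data.Nat.GCD using (gcd; gcd-GCD; gcd-zeroˡ; gcd-zeroʳ; module Bézout)
  open import Data.Nat.Induction using (<-rec)
  open import Data.Nat.Properties
  import Algebra.Properties.CommutativeSemigroup *-commutativeSemigroup as *
  import Algebra.Properties.CommutativeSemigroup +-commutativeSemigroup as +

  private variable
    A : Set

  -- Delayed sequences and recurrences with a delay

  -- Polymorphic so that the same delay serves for coefficients, with default 0, and for lists of
  -- partitions, with default `[]`; `shift-map` links the two.
  shift : A → ℕ → (ℕ → A) → ℕ → A
  shift z zero    g n       = g n
  shift z (suc c) g zero    = z
  shift z (suc c) g (suc n) = shift z c g n

  -- A delay of at least one looks only at earlier indices. This drives the well-founded induction
  -- on recurrences below.
  shift-local : ∀ (z : A) c {g h} n → (∀ {i} → i < n → g i ≡ h i) →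
                shift z (suc c) g n ≡ shift z (suc c) h n
  shift-local z c       zero    eq = refl
  shift-local z zero    (suc n) eq = eq ≤-refl
  shift-local z (suc c) (suc n) eq = shift-local z c n (eq ∘ m<n⇒m<1+n)

  module Recurrence (_⊕_ : A → A → A) (z : A) (c : ℕ) (f : ℕ → A) where

    Solution : (ℕ → A) → Set
    Solution g = ∀ n → g n ≡ f n ⊕ shift z (suc c) g n

    solution-unique : ∀ {g h} → Solution g → Solution h → g ≗ h
    solution-unique {g} {h} gs hs = <-rec _ λ n rec → begin
      g n                          ≡⟨ gs n ⟩
      f n ⊕ shift z (suc c) g n    ≡⟨ cong (f n ⊕_) (shift-local z c n rec) ⟩
      f n ⊕ shift z (suc c) h n    ≡⟨ hs n ⟨
      h n                          ∎
      where open ≡-Reasoning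

    -- The fuel `l` makes the recursion structural. The value at `n` is settled once `l` exceeds
    -- `n`, so `solution` takes `suc n`.
    approximation : ℕ → ℕ → A
    approximation zero    n = z
    approximation (suc l) n = f n ⊕ shift z (suc c) (approximation l) n

    approximation-stable : ∀ l l′ n → n < l → n < l′ → approximation l n ≡ approximation l′ n
    approximation-stable (suc l) (suc l′) n (s≤s n≤l) (s≤s n≤l′) =
      cong (f n ⊕_) (shift-local z c n λ i<n →
        approximation-stable l l′ _ (≤-trans i<n n≤l) (≤-trans i<n n≤l′))

    solution : ℕ → A
    solution n = approximation (suc n) n

    solution-correct : Solution solution
    solution-correct n = cong (f n ⊕_) (shift-local z c n λ {i} i<n →
      approximation-stable n (suc i) i i<n ≤-refl)

  -- Power series and multiplication by geometric series

  open Recurrence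

  -- Power series are represented by their coefficients: c ≫_ is multiplication by x^c.
  infixr 8 _≫_
  _≫_ : ℕ → (ℕ → ℕ) → ℕ → ℕ
  _≫_ = shift 0

  infixl 6 _⊞_
  _⊞_ : (f g : ℕ → ℕ) → ℕ → ℕ
  (f ⊞ g) n = f n + g n

  ≫-cong : ∀ c {f g} → f ≗ g → c ≫ f ≗ c ≫ g
  ≫-cong zero    eq n       = eq n
  ≫-cong (suc c) eq zero    = refl
  ≫-cong (suc c) eq (suc n) = ≫-cong c eq n

  ≫-⊞ : ∀ c f g → c ≫ (f ⊞ g) ≗ c ≫ f ⊞ c ≫ g
  ≫-⊞ zero    f g n       = refl
  ≫-⊞ (suc c) f g zero    = refl
  ≫-⊞ (suc c) f g (suc n) = ≫-⊞ c f g n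

  ≫-suc : ∀ c f → suc c ≫ f ≗ 1 ≫ c ≫ f
  ≫-suc c f zero    = refl
  ≫-suc c f (suc n) = refl

  ≫-+ : ∀ c d f → (c + d) ≫ f ≗ c ≫ d ≫ f
  ≫-+ zero    d f n       = refl
  ≫-+ (suc c) d f zero    = refl
  ≫-+ (suc c) d f (suc n) = ≫-+ c d f n

  ≫-comm : ∀ c d f → c ≫ d ≫ f ≗ d ≫ c ≫ f
  ≫-comm c d f n = begin
    (c ≫ d ≫ f) n   ≡⟨ ≫-+ c d f n ⟨
    ((c + d) ≫ f) n ≡⟨ cong (λ e → (e ≫ f) n) (+-comm c d) ⟩
    ((d + c) ≫ f) n ≡⟨ ≫-+ d c f n ⟩
    (d ≫ c ≫ f) n   ∎
    where open ≡-Reasoning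

  -- Multiplication by 1/(1 - x^c). Reading c = 0 as c = 1 makes the laws below unconditional.
  geo : ℕ → (ℕ → ℕ) → ℕ → ℕ
  geo c f = solution _+_ 0 (pred c) f

  step : ℕ → ℕ
  step c = suc (pred c)

  geo-unfold : ∀ c f → geo c f ≗ f ⊞ step c ≫ geo c f
  geo-unfold c f = solution-correct _+_ 0 (pred c) f

  -- The laws of `geo` below are proved through this: the candidate is shown to satisfy the same
  -- recurrence.
  geo-unique : ∀ c f {g} → g ≗ f ⊞ step c ≫ g → g ≗ geo c f
  geo-unique c f eq = solution-unique _+_ 0 (pred c) f eq (geo-unfold c f)

  geo-cong : ∀ c {f g} → f ≗ g → geo c f ≗ geo c g
  geo-cong c {f} {g} eq = geo-unique c g λ n →
    trans (geo-unfold c f n) (cong (_+ _) (eq n))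

  geo-⊞ : ∀ c f g → geo c (f ⊞ g) ≗ geo c f ⊞ geo c g
  geo-⊞ c f g n = sym (geo-unique c (f ⊞ g) eq n)
    where
    open ≡-Reasoning
    s = step c
    eq : geo c f ⊞ geo c g ≗ (f ⊞ g) ⊞ s ≫ (geo c f ⊞ geo c g)
    eq n = begin
      geo c f n + geo c g n
        ≡⟨ cong₂ _+_ (geo-unfold c f n) (geo-unfold c g n) ⟩
      (f n + (s ≫ geo c f) n) + (g n + (s ≫ geo c g) n)
        ≡⟨ +.interchange (f n) _ (g n) _ ⟩
      (f n + g n) + ((s ≫ geo c f) n + (s ≫ geo c g) n)
        ≡⟨ cong (f n + g n +_) (≫-⊞ s (geo c f) (geo c g) n) ⟨
      (f n + g n) + (s ≫ (geo c f ⊞ geo c g)) n ∎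

  geo-≫ : ∀ c d f → geo c (d ≫ f) ≗ d ≫ geo c f
  geo-≫ c d f n = sym (geo-unique c (d ≫ f) eq n)
    where
    open ≡-Reasoning
    s = step c
    eq : d ≫ geo c f ≗ d ≫ f ⊞ s ≫ d ≫ geo c f
    eq n = begin
      (d ≫ geo c f) n                     ≡⟨ ≫-cong d (geo-unfold c f) n ⟩
      (d ≫ (f ⊞ s ≫ geo c f)) n           ≡⟨ ≫-⊞ d f (s ≫ geo c f) n ⟩
      (d ≫ f) n + (d ≫ s ≫ geo c f) n     ≡⟨ cong ((d ≫ f) n +_) (≫-comm d s (geo c f) n) ⟩
      (d ≫ f) n + (s ≫ d ≫ geo c f) n     ∎

  -- `geo c` is additive and commutes with delays, so it carries the recurrence of `geo d f` to that
  -- of `geo d (geo c f)`.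
  geo-comm : ∀ c d f → geo c (geo d f) ≗ geo d (geo c f)
  geo-comm c d f = geo-unique d (geo c f) λ n → begin
    geo c (geo d f) n                           ≡⟨ geo-cong c (geo-unfold d f) n ⟩
    geo c (f ⊞ s ≫ geo d f) n                   ≡⟨ geo-⊞ c f (s ≫ geo d f) n ⟩
    geo c f n + geo c (s ≫ geo d f) n           ≡⟨ cong (geo c f n +_) (geo-≫ c s (geo d f) n) ⟩
    geo c f n + (s ≫ geo c (geo d f)) n         ∎
    where
    open ≡-Reasoning
    s = step d

  δ : ℕ → ℕ
  δ zero    = 1
  δ (suc n) = 0

  -- The coefficients of ∏_{c ∈ L} 1/(1 - x^c), i.e. partitions into parts from the multiset L.
  P : List ℕ → ℕ → ℕ
  P = foldr geo δ

  P-↭ : ∀ {L M} → L ↭ M → P L ≗ P M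
  P-↭ Perm.refl n = refl
  P-↭ (Perm.prep x p) n = geo-cong x (P-↭ p) n
  P-↭ (Perm.swap {xs = L} x y p) n = trans (geo-comm x y (P L) n) (geo-cong y (geo-cong x (P-↭ p)) n)
  P-↭ (Perm.trans p q) n = trans (P-↭ p n) (P-↭ q n)

  -- The total number of parts equal to c, over all partitions into parts from L ∋ c.
  occurrences : List ℕ → ℕ → ℕ → ℕ
  occurrences L c = step c ≫ geo c (P L)

  -- Enumeration of partitions with prescribed parts

  shift-map : ∀ {A B : Set} (h : A → B) z c g n →
              h (shift z c g n) ≡ shift (h z) c (h ∘ g) n
  shift-map h z zero    g n       = refl
  shift-map h z (suc c) g zero    = refl
  shift-map h z (suc c) g (suc n) = shift-map h z c g n

  module _ {A : Set} where

    ∈-shift⁺ : ∀ c {g : ℕ → List A} {n y} → y ∈ g n → y ∈ shift [] c g (c + n)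
    ∈-shift⁺ zero    y∈ = y∈
    ∈-shift⁺ (suc c) y∈ = ∈-shift⁺ c y∈

    ∈-shift⁻ : ∀ c {g : ℕ → List A} n {y} → y ∈ shift [] c g n → ∃[ m ] n ≡ c + m × y ∈ g m
    ∈-shift⁻ zero    n       y∈ = n , refl , y∈
    ∈-shift⁻ (suc c) (suc n) y∈ with ∈-shift⁻ c n y∈
    ... | m , refl , y∈′ = m , refl , y∈′

    shift-unique : ∀ c {g : ℕ → List A} n → (∀ m → n ≡ c + m → Unique (g m)) → Unique (shift [] c g n)
    shift-unique zero    n       u = u n refl
    shift-unique (suc c) zero    u = []
    shift-unique (suc c) (suc n) u = shift-unique c n (λ m eq → u m (cong suc eq))

  -- The recurrence of `geo` with lists in place of numbers: a partition either has no part `c`, or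
  -- begins with one that can be removed. For decreasing positive `L` all lists come out weakly
  -- decreasing.
  enum : List ℕ → ℕ → List (List ℕ)
  enum []      zero    = [] ∷ []
  enum []      (suc n) = []
  enum (c ∷ L) = solution (λ ps qs → ps ++ map (step c ∷_) qs) [] (pred c) (enum L)

  enum-unfold : ∀ c L n → enum (c ∷ L) n ≡
                enum L n ++ map (step c ∷_) (shift [] (step c) (enum (c ∷ L)) n)
  enum-unfold c L = solution-correct (λ ps qs → ps ++ map (step c ∷_) qs) [] (pred c) (enum L)

  enum-length : ∀ L → length ∘ enum L ≗ P L
  enum-length []      zero    = refl
  enum-length []      (suc n) = refl
  enum-length (c ∷ L) = geo-unique c (P L) λ n →
    let qs = shift [] (step c) (enum (c ∷ L)) n in begin
    length (enum (c ∷ L) n)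
      ≡⟨ cong length (enum-unfold c L n) ⟩
    length (enum L n ++ map (step c ∷_) qs)
      ≡⟨ length-++ (enum L n) ⟩
    length (enum L n) + length (map (step c ∷_) qs)
      ≡⟨ cong₂ _+_ (enum-length L n) (length-map _ qs) ⟩
    P L n + length qs
      ≡⟨ cong (P L n +_) (shift-map length [] (step c) (enum (c ∷ L)) n) ⟩
    P L n + (step c ≫ length ∘ enum (c ∷ L)) n ∎
    where open ≡-Reasoning

  -- Total number of parts

  totalLength : List (List ℕ) → ℕ
  totalLength ps = sum (map length ps)

  totalLength-++ : ∀ ps qs → totalLength (ps ++ qs) ≡ totalLength ps + totalLength qs
  totalLength-++ ps qs = trans (cong sum (map-++ length ps qs)) (sum-++ (map length ps) _)

  totalLength-map-∷ : ∀ x ps → totalLength (map (x ∷_) ps) ≡ length ps + totalLength ps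
  totalLength-map-∷ x []       = refl
  totalLength-map-∷ x (p ∷ ps) = cong suc $ begin
    length p + totalLength (map (x ∷_) ps)       ≡⟨ cong (length p +_) (totalLength-map-∷ x ps) ⟩
    length p + (length ps + totalLength ps)      ≡⟨ +.x∙yz≈y∙xz (length p) (length ps) _ ⟩
    length ps + (length p + totalLength ps)      ∎
    where open ≡-Reasoning

  total : (ℕ → ℕ → ℕ) → List ℕ → ℕ → ℕ
  total F L n = sum (map (λ c → F c n) L)

  geo-0 : ∀ c → geo c (λ _ → 0) ≗ λ _ → 0
  geo-0 c n = sym (geo-unique c (λ _ → 0) (sym ∘ ≫-0 (step c)) n)
    where
    ≫-0 : ∀ c → c ≫ (λ _ → 0) ≗ λ _ → 0
    ≫-0 zero    n       = refl
    ≫-0 (suc c) zero    = refl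
    ≫-0 (suc c) (suc n) = ≫-0 c n

  geo-total : ∀ c F L → geo c (total F L) ≗ total (geo c ∘ F) L
  geo-total c F []      n = geo-0 c n
  geo-total c F (a ∷ L) n = trans (geo-⊞ c (F a) (total F L) n) (cong (_ +_) (geo-total c F L n))

  total-cong : ∀ {F G} L → (∀ c → F c ≗ G c) → total F L ≗ total G L
  total-cong []      eq n = refl
  total-cong (c ∷ L) eq n = cong₂ _+_ (eq c n) (total-cong L eq n)

  -- Each list that begins with `c` contributes one for that part, so the total length obeys the
  -- recurrence of `geo c` with the extra source `s ≫ P (c ∷ L)`. By additivity this source yields
  -- the occurrences of `c`, and the rest yields those of the entries of `L`.
  enum-totalLength : ∀ L → totalLength ∘ enum L ≗ total (occurrences L) L
  enum-totalLength []      zero    = refl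
  enum-totalLength []      (suc n) = refl
  enum-totalLength (c ∷ L) n = begin
    totalLength (enum (c ∷ L) n)
      ≡⟨ geo-unique c (total (occurrences L) L ⊞ s ≫ P (c ∷ L)) recurrence n ⟩
    geo c (total (occurrences L) L ⊞ s ≫ P (c ∷ L)) n
      ≡⟨ geo-⊞ c (total (occurrences L) L) (s ≫ P (c ∷ L)) n ⟩
    geo c (total (occurrences L) L) n + geo c (s ≫ P (c ∷ L)) n
      ≡⟨ cong₂ _+_ (geo-total c (occurrences L) L n) (geo-≫ c s (P (c ∷ L)) n) ⟩
    total (geo c ∘ occurrences L) L n + occurrences (c ∷ L) c n
      ≡⟨ cong (_+ occurrences (c ∷ L) c n) (total-cong L geo-occurrences n) ⟩
    total (occurrences (c ∷ L)) L n + occurrences (c ∷ L) c n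
      ≡⟨ +-comm (total (occurrences (c ∷ L)) L n) _ ⟩
    total (occurrences (c ∷ L)) (c ∷ L) n ∎
    where
    open ≡-Reasoning
    s = step c
    T = totalLength ∘ enum (c ∷ L)

    geo-occurrences : ∀ a → geo c (occurrences L a) ≗ occurrences (c ∷ L) a
    geo-occurrences a n = trans (geo-≫ c (step a) (geo a (P L)) n)
                                  (≫-cong (step a) (geo-comm c a (P L)) n)

    recurrence : T ≗ total (occurrences L) L ⊞ s ≫ P (c ∷ L) ⊞ s ≫ T
    recurrence n = let qs = shift [] s (enum (c ∷ L)) n in begin
      T n
        ≡⟨ cong totalLength (enum-unfold c L n) ⟩
      totalLength (enum L n ++ map (s ∷_) qs)
        ≡⟨ totalLength-++ (enum L n) _ ⟩
      totalLength (enum L n) + totalLength (map (s ∷_) qs)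
        ≡⟨ cong₂ _+_ (enum-totalLength L n) (totalLength-map-∷ s qs) ⟩
      total (occurrences L) L n + (length qs + totalLength qs)
        ≡⟨ cong (total (occurrences L) L n +_) (cong₂ _+_
             (trans (shift-map length [] s (enum (c ∷ L)) n) (≫-cong s (enum-length (c ∷ L)) n))
             (shift-map totalLength [] s (enum (c ∷ L)) n)) ⟩
      total (occurrences L) L n + ((s ≫ P (c ∷ L)) n + (s ≫ T) n)
        ≡⟨ +-assoc (total (occurrences L) L n) _ _ ⟨
      total (occurrences L) L n + (s ≫ P (c ∷ L)) n + (s ≫ T) n ∎

  -- The enumeration agrees with `partitions`

  -- Strict decrease makes the head of `L` the largest admissible part, so it may be put in front of
  -- any list; positivity makes `step` the identity on `L`. The inner induction on `n` removes one
  -- copy of the head.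
  enum-sound : ∀ {L} → All (0 <_) L → AllPairs _>_ L → ∀ n {p} →
               p ∈ enum L n → IsPartition (_∈ L) n p
  enum-sound []           []        zero (here refl) = isPartition [] [] refl []
  enum-sound {suc c ∷ L} (s≤s _ ∷ ps) (c> ∷ ds) = <-rec _ λ n rec {p} p∈ →
    sound n rec (∈-++⁻ (enum L n) (subst (_ ∈_) (enum-unfold (suc c) L n) p∈))
    where
    bounded : ∀ {x} → x ∈ suc c ∷ L → x ≤ suc c
    bounded (here refl) = ≤-refl
    bounded (there x∈)    = <⇒≤ (All.lookup c> x∈)

    sound : ∀ n → (∀ {m} → m < n → ∀ {p} → p ∈ enum (suc c ∷ L) m → IsPartition (_∈ suc c ∷ L) m p) →
            ∀ {p} → p ∈ enum L n ⊎ p ∈ map (suc c ∷_) (shift [] (suc c) (enum (suc c ∷ L)) n) →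
            IsPartition (_∈ suc c ∷ L) n p
    sound n rec (inj₁ p∈) with isPartition d q s m ← enum-sound ps ds n p∈ =
      isPartition d q s (All.map there m)
    sound n rec (inj₂ p∈) with ∈-map⁻ (suc c ∷_) p∈
    ... | r , r∈ , refl with ∈-shift⁻ (suc c) n r∈
    ...   | m , refl , r∈′ with rec (m<n+m m z<s) r∈′
    ...     | isPartition d q s i =
      isPartition (link d i) (z<s ∷ q) (cong (suc c +_) s) (here refl ∷ i)
      where
      link : ∀ {r} → Linked _≥_ r → All (_∈ suc c ∷ L) r → Linked _≥_ (suc c ∷ r)
      link []      _        = [-]
      link [-]     (x∈ ∷ _) = bounded x∈ ∷ [-]
      link (x ∷ d) (x∈ ∷ _) = bounded x∈ ∷ x ∷ d

  enum-complete : ∀ {L} → All (0 <_) L → AllPairs _>_ L → ∀ n {p} →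
                  IsPartition (_∈ L) n p → p ∈ enum L n
  enum-complete []  [] _ {[]} (isPartition _ _ refl _) = here refl
  enum-complete []  [] _ {_ ∷ _} (isPartition _ _ _ (() ∷ _))
  enum-complete {suc c ∷ L} (s≤s _ ∷ ps) (c> ∷ ds) = <-rec _ λ n rec {p} P →
    subst (_ ∈_) (sym (enum-unfold (suc c) L n)) (complete n rec p P)
    where
    complete : ∀ n → (∀ {m} → m < n → ∀ {p} → IsPartition (_∈ suc c ∷ L) m p → p ∈ enum (suc c ∷ L) m) →
               ∀ p → IsPartition (_∈ suc c ∷ L) n p →
               p ∈ enum L n ++ map (suc c ∷_) (shift [] (suc c) (enum (suc c ∷ L)) n)
    complete n rec [] (isPartition d q s m) =
      ∈-++⁺ˡ (enum-complete ps ds n (isPartition d q s []))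
    complete n rec (x ∷ p) (isPartition d (_ ∷ q) refl (here refl ∷ i)) =
      ∈-++⁺ʳ (enum L n) (∈-map⁺ (suc c ∷_) (∈-shift⁺ (suc c)
        (rec (m<n+m (sum p) z<s) (isPartition (Linked.tail d) q refl i))))
    complete n rec (x ∷ p) (isPartition d q s (there x∈ ∷ i)) =
      ∈-++⁺ˡ (enum-complete ps ds n (isPartition d q s (inTail x∈ d i)))
      where
      inTail : ∀ {x p} → x ∈ L → Linked _≥_ (x ∷ p) → All (_∈ suc c ∷ L) p → All (_∈ L) (x ∷ p)
      inTail x∈ [-]       []                 = x∈ ∷ []
      -- A later part `suc c` would exceed the part before it, which is an entry of `L`.
      inTail x∈ (x≥y ∷ d) (here refl ∷ i)  = ⊥-elim (<⇒≱ (All.lookup c> x∈) x≥y)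
      inTail x∈ (x≥y ∷ d) (there y∈ ∷ i)     = x∈ ∷ inTail y∈ d i

  -- The two halves of the recurrence are disjoint: lists in the second begin with `suc c`, which is
  -- not an entry of `L`.
  enum-unique : ∀ {L} → All (0 <_) L → AllPairs _>_ L → ∀ n → Unique (enum L n)
  enum-unique []  []  zero    = [] ∷ []
  enum-unique []  []  (suc n) = []
  enum-unique {suc c ∷ L} (s≤s _ ∷ ps) (c> ∷ ds) = <-rec _ λ n rec →
    subst Unique (sym (enum-unfold (suc c) L n)) (Unique.++⁺
      (enum-unique ps ds n)
      (Unique.map⁺ ∷-injectiveʳ (shift-unique (suc c) n λ { m refl → rec (m<n+m m z<s) }))
      (λ (p∈ , p∈′) → disjoint n p∈ p∈′))
    where
    disjoint : ∀ n {p X} → p ∈ enum L n → p ∈ map (suc c ∷_) X → ⊥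
    disjoint n p∈ p∈′ with ∈-map⁻ (suc c ∷_) p∈′
    ... | _ , _ , refl with enum-sound ps ds n p∈
    ...   | isPartition _ _ _ (c∈ ∷ _) = <-irrefl refl (All.lookup c> c∈)

  -- Duplicate-free lists with the same members are permutations of each other, so only membership
  -- has to be compared.
  enum-↭-partitions : ∀ {A : Pred ℕ 0ℓ} (A? : Decidable A) {L} → All (0 <_) L → AllPairs _>_ L →
    (∀ {x} → A x → x ∈ L) → (∀ {x} → x ∈ L → A x) →
    ∀ n → partitions A? n ↭ enum L n
  enum-↭-partitions A? {L} ps ds A⇒L L⇒A n = ∼bag⇒↭ (unique∧set⇒bag
    (partitions-unique A? n) (enum-unique ps ds n)
    λ {p} → mk⇔
      (λ p∈ → let isPartition d q s i = Equivalence.to (∈-partitions A? n p) p∈ in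
        enum-complete ps ds n (isPartition d q s (All.map A⇒L i)))
      (λ p∈ → let isPartition d q s i = enum-sound ps ds n p∈ in
        Equivalence.from (∈-partitions A? n p) (isPartition d q s (All.map L⇒A i))))

  -- Agreement up to O(n^d)

  infix 4 _≈[_]_
  -- This is f(n) = g(n) + O(n^d). The base `suc n` stays positive at 0, so the bound can hold for
  -- every `n` without a threshold.
  record _≈[_]_ (f : ℕ → ℕ) (d : ℕ) (g : ℕ → ℕ) : Set where
    constructor within
    field
      constant : ℕ
      distance : ∀ n → ∣ f n - g n ∣ ≤ constant * suc n ^ d

  infixr 7 _·_
  _·_ : ℕ → (ℕ → ℕ) → ℕ → ℕ
  (k · f) n = k * f n

  ∣-∣-+ : ∀ a b c d → ∣ a + b - c + d ∣ ≤ ∣ a - c ∣ + ∣ b - d ∣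
  ∣-∣-+ a b c d = begin
    ∣ a + b - c + d ∣                       ≤⟨ ∣-∣-triangle (a + b) (c + b) (c + d) ⟩
    ∣ a + b - c + b ∣ + ∣ c + b - c + d ∣   ≡⟨ cong₂ _+_ lemma (∣m+n-m+o∣≡∣n-o∣ c b d) ⟩
    ∣ a - c ∣ + ∣ b - d ∣                   ∎
    where
    open ≤-Reasoning
    lemma : ∣ a + b - c + b ∣ ≡ ∣ a - c ∣
    lemma = trans (cong₂ ∣_-_∣ (+-comm a b) (+-comm c b)) (∣m+n-m+o∣≡∣n-o∣ b a c)

  module _ {d : ℕ} where

    ≗⇒≈ : ∀ {f g} → f ≗ g → f ≈[ d ] g
    ≗⇒≈ eq = within 0 λ n → ≤-reflexive (m≡n⇒∣m-n∣≡0 (eq n))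

    ≈-sym : ∀ {f g} → f ≈[ d ] g → g ≈[ d ] f
    ≈-sym {f} {g} (within C p) = within C λ n → ≤-trans (≤-reflexive (∣-∣-comm (g n) (f n))) (p n)

    ≈-trans : ∀ {f g h} → f ≈[ d ] g → g ≈[ d ] h → f ≈[ d ] h
    ≈-trans {f} {g} {h} (within C p) (within D q) = within (C + D) λ n → begin
      ∣ f n - h n ∣                     ≤⟨ ∣-∣-triangle (f n) (g n) (h n) ⟩
      ∣ f n - g n ∣ + ∣ g n - h n ∣     ≤⟨ +-mono-≤ (p n) (q n) ⟩
      C * suc n ^ d + D * suc n ^ d     ≡⟨ *-distribʳ-+ (suc n ^ d) C D ⟨
      (C + D) * suc n ^ d               ∎
      where open ≤-Reasoning

    ≈-⊞ : ∀ {f f′ g g′} → f ≈[ d ] f′ → g ≈[ d ] g′ → f ⊞ g ≈[ d ] f′ ⊞ g′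
    ≈-⊞ {f} {f′} {g} {g′} (within C p) (within D q) = within (C + D) λ n → begin
      ∣ f n + g n - f′ n + g′ n ∣       ≤⟨ ∣-∣-+ (f n) (g n) (f′ n) (g′ n) ⟩
      ∣ f n - f′ n ∣ + ∣ g n - g′ n ∣   ≤⟨ +-mono-≤ (p n) (q n) ⟩
      C * suc n ^ d + D * suc n ^ d     ≡⟨ *-distribʳ-+ (suc n ^ d) C D ⟨
      (C + D) * suc n ^ d               ∎
      where open ≤-Reasoning

    ≈-· : ∀ k {f g} → f ≈[ d ] g → k · f ≈[ d ] k · g
    ≈-· k {f} {g} (within C p) = within (k * C) λ n → begin
      ∣ k * f n - k * g n ∣             ≡⟨ *-distribˡ-∣-∣ k (f n) (g n) ⟨
      k * ∣ f n - g n ∣                 ≤⟨ *-monoʳ-≤ k (p n) ⟩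
      k * (C * suc n ^ d)               ≡⟨ *-assoc k C (suc n ^ d) ⟨
      k * C * suc n ^ d                 ∎
      where open ≤-Reasoning

    -- A delay evaluates the error at an earlier index, where the bound is no larger; before the
    -- delay has passed, both sides are 0.
    ≈-≫ : ∀ h {f g} → f ≈[ d ] g → h ≫ f ≈[ d ] h ≫ g
    ≈-≫ h {f} {g} (within C p) = within C (go h)
      where
      go : ∀ h n → ∣ (h ≫ f) n - (h ≫ g) n ∣ ≤ C * suc n ^ d
      go zero    n       = p n
      go (suc h) zero    = z≤n
      go (suc h) (suc n) = ≤-trans (go h n) (*-monoʳ-≤ C (^-monoˡ-≤ d (n≤1+n (suc n))))

    ≈-small : ∀ {f h} C → (∀ n → f n ≤ C * suc n ^ d) → f ⊞ h ≈[ d ] h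
    ≈-small {f} {h} C f≤ = within C λ n → ≤-trans (≤-reflexive (begin
      ∣ f n + h n - h n ∣       ≡⟨ cong ∣_- h n ∣ (+-comm (f n) (h n)) ⟩
      ∣ h n + f n - h n ∣       ≡⟨ ∣-∣-comm (h n + f n) (h n) ⟩
      ∣ h n - h n + f n ∣       ≡⟨ ∣m-m+n∣≡n (h n) (f n) ⟩
      f n                       ∎)) (f≤ n)
      where open ≡-Reasoning

  ≈-id· : ∀ {d f g} → f ≈[ d ] g → (λ n → n * f n) ≈[ suc d ] (λ n → n * g n)
  ≈-id· {d} {f} {g} (within C p) = within C λ n → begin
    ∣ n * f n - n * g n ∣             ≡⟨ *-distribˡ-∣-∣ n (f n) (g n) ⟨
    n * ∣ f n - g n ∣                 ≤⟨ *-mono-≤ (n≤1+n n) (p n) ⟩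
    suc n * (C * suc n ^ d)           ≡⟨ *.x∙yz≈y∙xz (suc n) C (suc n ^ d) ⟩
    C * suc n ^ suc d                 ∎
    where open ≤-Reasoning

  -- Approximate periods

  -- Up to O(n^d), the periods of g are closed under addition and cancellation, hence under gcd by Bézout.
  module Periods (d : ℕ) (g : ℕ → ℕ) where

    Period : ℕ → Set
    Period h = h ≫ g ≈[ d ] g

    period-+ : ∀ h k → Period h → Period k → Period (h + k)
    period-+ h k p q = ≈-trans (≗⇒≈ (≫-+ h k g)) (≈-trans (≈-≫ h q) p)

    period-cancel : ∀ h k → Period (h + k) → Period k → Period h
    period-cancel h k p q =
      ≈-trans (≈-≫ h (≈-sym q)) (≈-trans (≗⇒≈ (sym ∘ ≫-+ h k g)) p)

    period-* : ∀ x {h} → Period h → Period (x * h)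
    period-* zero        p = ≗⇒≈ λ _ → refl
    period-* (suc x) {h} p = period-+ h (x * h) p (period-* x p)

    period-gcd : ∀ m n → Period m → Period n → Period (gcd m n)
    period-gcd m n p q with Bézout.identity (gcd-GCD m n)
    -- Coefficients are natural numbers, so Bézout's identity has two forms; here it reads
    -- `gcd m n + y * n ≡ x * m`.
    ... | Bézout.+- x y eq = period-cancel (gcd m n) (y * n)
          (subst Period (sym eq) (period-* x p)) (period-* y q)
    ... | Bézout.-+ x y eq = period-cancel (gcd m n) (x * m)
          (subst Period (sym eq) (period-* y q)) (period-* x p)

    period-gcds : ∀ {L} → All Period L → Period (foldr gcd 0 L)
    period-gcds         []       = ≗⇒≈ λ _ → refl
    period-gcds {x ∷ L} (p ∷ ps) = period-gcd x (foldr gcd 0 L) p (period-gcds ps)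

  -- Growth and periods of `P`

  ≫-bound : ∀ c {f B} n → (∀ {i} → i < n → f i ≤ B) → (suc c ≫ f) n ≤ B
  ≫-bound c       zero    f≤ = z≤n
  ≫-bound zero    (suc n) f≤ = f≤ ≤-refl
  ≫-bound (suc c) (suc n) f≤ = ≫-bound c n (f≤ ∘ m<n⇒m<1+n)

  -- By induction the delayed value is at most `n * suc n ^ d`; with the bound on `f n` this makes
  -- `suc n` copies of `suc n ^ d`.
  geo-growth : ∀ c d {f} → (∀ n → f n ≤ suc n ^ d) → ∀ n → geo c f n ≤ suc n ^ suc d
  geo-growth c d {f} f≤ = <-rec _ λ n rec → begin
    geo c f n                     ≡⟨ geo-unfold c f n ⟩
    f n + (step c ≫ geo c f) n    ≤⟨ +-mono-≤ (f≤ n) (≫-bound (pred c) n λ i<n →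
                                       ≤-trans (rec i<n) (*-mono-≤ i<n (^-monoˡ-≤ d (m≤n⇒m≤1+n i<n)))) ⟩
    suc n ^ d + n * suc n ^ d     ∎
    where open ≤-Reasoning

  -- Base case of `P-growth`. Applying `geo-growth` to `δ` would cost one power of n too many.
  geo-δ≤1 : ∀ c n → geo c δ n ≤ 1
  geo-δ≤1 c = <-rec _ λ where
    zero    rec → ≤-reflexive (geo-unfold c δ 0)
    (suc n) rec → ≤-trans (≤-reflexive (geo-unfold c δ (suc n))) (≫-bound (pred c) (suc n) rec)

  P-growth : ∀ c L n → P (c ∷ L) n ≤ suc n ^ length L
  P-growth c []      = geo-δ≤1 c
  P-growth c (b ∷ L) = geo-growth c (length L) (P-growth b L)

  open Periods

  -- By its recurrence, `geo c f` differs from its delay by exactly `f`.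
  period-geo : ∀ {d} c f → (∀ n → f n ≤ suc n ^ d) → Period d (geo c f) (step c)
  period-geo {d} c f f≤ = ≈-trans
    (≈-sym (≈-small {f = f} 1 λ n → ≤-trans (f≤ n) (≤-reflexive (sym (*-identityˡ _)))))
    (≗⇒≈ (sym ∘ geo-unfold c f))

  period-resp-≗ : ∀ {d f g} h → f ≗ g → Period d f h → Period d g h
  period-resp-≗ h eq p = ≈-trans (≗⇒≈ (≫-cong h (sym ∘ eq))) (≈-trans p (≗⇒≈ eq))

  -- By commutativity `c` may come first. Then `P L` arises by `geo c` from a series for `1 + d`
  -- parts, which is O(n^d) by `P-growth`.
  P-period : ∀ {d L} → length L ≡ 2 + d → ∀ {c} → c ∈ L → Period d (P L) c
  P-period {d} len {zero}  c∈ = ≗⇒≈ λ _ → refl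
  P-period {d} len {suc c} c∈ with xs , ys , refl ← ∈-∃++ c∈ =
    period-resp-≗ (suc c) (P-↭ (↭-sym (↭.shift (suc c) xs ys)))
      (helper (xs ++ ys) (trans (sym (↭.↭-length (↭.shift (suc c) xs ys))) len))
    where
    helper : ∀ M → suc (length M) ≡ 2 + d → Period d (P (suc c ∷ M)) (suc c)
    helper (b ∷ M) refl = period-geo (suc c) (P (b ∷ M)) (P-growth b M)

  P-period-1 : ∀ {d} L → length L ≡ 2 + d → foldr gcd 0 L ≡ 1 → Period d (P L) 1
  P-period-1 L len eq = subst (Period _ (P L)) eq
    (period-gcds _ (P L) (All.tabulate {xs = L} (P-period {L = L} len)))

  -- Replacing a part by 1

  -- window r g is g · (1 - x^r)/(1 - x), so that taking g = f/(1 - x^c) and r = c yields f/(1 - x).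
  window : ℕ → (ℕ → ℕ) → ℕ → ℕ
  window zero    g n = 0
  window (suc r) g   = window r g ⊞ r ≫ g

  -- Both sides are the window of length `suc c`. This is (1 + x + ... + x^(c - 1))(1 - x) = 1 - x^c
  -- without subtraction.
  window-slide : ∀ c g → g ⊞ 1 ≫ window c g ≗ window c g ⊞ c ≫ g
  window-slide zero    g zero    = +-identityʳ (g 0)
  window-slide zero    g (suc n) = +-identityʳ (g (suc n))
  window-slide (suc r) g n = begin
    g n + (1 ≫ (window r g ⊞ r ≫ g)) n          ≡⟨ cong (g n +_) (≫-⊞ 1 (window r g) (r ≫ g) n) ⟩
    g n + ((1 ≫ window r g) n + (1 ≫ r ≫ g) n)  ≡⟨ +-assoc (g n) _ _ ⟨
    g n + (1 ≫ window r g) n + (1 ≫ r ≫ g) n    ≡⟨ cong₂ _+_ (window-slide r g n) (sym (≫-suc r g n)) ⟩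
    window (suc r) g n + (suc r ≫ g) n          ∎
    where open ≡-Reasoning

  window-geo : ∀ c f → window (step c) (geo c f) ≗ geo 1 f
  window-geo c f = geo-unique 1 f λ n → +-cancelʳ-≡ ((s ≫ g) n) _ _ (begin
    W n + (s ≫ g) n                     ≡⟨ window-slide s g n ⟨
    g n + (1 ≫ W) n                     ≡⟨ cong (_+ (1 ≫ W) n) (geo-unfold c f n) ⟩
    f n + (s ≫ g) n + (1 ≫ W) n         ≡⟨ +.xy∙z≈xz∙y (f n) ((s ≫ g) n) _ ⟩
    f n + (1 ≫ W) n + (s ≫ g) n         ∎)
    where
    open ≡-Reasoning
    s = step c
    g = geo c f
    W = window s g

  -- If 1 is a period then so is every number, so each of the `r` delayed copies of `g` in the
  -- window counts as `g`.
  window-≈ : ∀ {d g} r → Period d g 1 → r · g ≈[ d ] window r g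
  window-≈         zero    p = ≗⇒≈ λ _ → refl
  window-≈ {d} {g} (suc r) p = ≈-trans
    (≗⇒≈ λ n → +-comm (g n) (r * g n))
    (≈-⊞ (window-≈ r p) (≈-sym (subst (Period d g) (*-identityʳ r) (period-* d g r p))))

  geo-≈ : ∀ {d} c f → Period d (geo c f) 1 → step c · geo c f ≈[ d ] geo 1 f
  geo-≈ c f p = ≈-trans (window-≈ (step c) p) (≗⇒≈ (window-geo c f))

  ones : ℕ → List ℕ
  ones j = replicate j 1

  -- Restores the gcd hypothesis once a part has been replaced by 1.
  gcds-∋1 : ∀ {L} → 1 ∈ L → foldr gcd 0 L ≡ 1
  gcds-∋1 {_ ∷ L} (here refl) = gcd-zeroˡ (foldr gcd 0 L)
  gcds-∋1 {x ∷ _} (there 1∈)    = trans (cong (gcd x) (gcds-∋1 1∈)) (gcd-zeroʳ x)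

  -- Since ∏ L · P L hardly changes when an entry of L is replaced by 1, all can be replaced in turn.
  P-≈-ones : ∀ {d} xs j → length (xs ++ ones j) ≡ 2 + d → foldr gcd 0 (xs ++ ones j) ≡ 1 →
             All (0 <_) xs → product xs · P (xs ++ ones j) ≈[ d ] P (ones (2 + d))
  P-≈-ones [] j len g [] = ≗⇒≈ λ n → trans (*-identityˡ _)
    (cong (λ i → P (ones i) n) (trans (sym (length-replicate j)) len))
  P-≈-ones {d} (suc c ∷ xs) j len g (s≤s _ ∷ ps) =
    ≈-trans (≗⇒≈ λ n → *.xy∙z≈y∙xz (suc c) (product xs) (P (suc c ∷ rest) n))
    (≈-trans (≈-· (product xs) (geo-≈ (suc c) (P rest) (P-period-1 (suc c ∷ rest) len g)))
    (≈-trans (≗⇒≈ λ n → cong (product xs *_) (P-↭ (↭-sym moved) n))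
    (P-≈-ones xs (suc j) (trans (↭.↭-length moved) len) (gcds-∋1 (∈-++⁺ʳ xs (here refl))) ps)))
    where
    rest = xs ++ ones j
    moved : xs ++ ones (suc j) ↭ 1 ∷ rest
    moved = ↭.shift 1 xs (ones j)

  -- Parts all equal to 1: rising factorials

  rising : ℕ → ℕ → ℕ
  rising zero    n = 1
  rising (suc k) n = (n + suc k) * rising k n

  -- Takes out the smallest factor, n + 1, where the definition takes out the largest.
  rising-suc : ∀ k n → rising (suc k) n ≡ suc n * rising k (suc n)
  rising-suc zero    n = cong (_* 1) (+-comm n 1)
  rising-suc (suc k) n = begin
    (n + suc (suc k)) * rising (suc k) n               ≡⟨ cong₂ _*_ (+-suc n (suc k)) (rising-suc k n) ⟩
    (suc n + suc k) * (suc n * rising k (suc n))       ≡⟨ *.x∙yz≈y∙xz (suc n + suc k) (suc n) _ ⟩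
    suc n * rising (suc k) (suc n)                     ∎
    where open ≡-Reasoning

  -- Pascal's rule for the binomial coefficient of n + k over k: the two terms of the recurrence of
  -- `geo 1` become k + 1 and n + 1 times `rising k (suc n)`.
  P-ones : ∀ k n → k ! * P (ones (suc k)) n ≡ rising k n
  P-ones zero n = trans (*-identityˡ _) (sym (geo-unique 1 δ {λ _ → 1} constant n))
    where
    constant : (λ _ → 1) ≗ δ ⊞ 1 ≫ (λ _ → 1)
    constant zero    = refl
    constant (suc n) = refl
  P-ones (suc k) zero = begin
    suc k ! * geo 1 f 0         ≡⟨ cong (suc k ! *_) (geo-unfold 1 f 0) ⟩
    suc k ! * (f 0 + 0)         ≡⟨ cong (suc k ! *_) (+-identityʳ (f 0)) ⟩
    suc k ! * f 0               ≡⟨ *-assoc (suc k) (k !) (f 0) ⟩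
    suc k * (k ! * f 0)         ≡⟨ cong (suc k *_) (P-ones k 0) ⟩
    suc k * rising k 0          ∎
    where
    open ≡-Reasoning
    f = P (ones (suc k))
  P-ones (suc k) (suc n) = begin
    suc k ! * geo 1 f (suc n)                          ≡⟨ cong (suc k ! *_) (geo-unfold 1 f (suc n)) ⟩
    suc k ! * (f (suc n) + geo 1 f n)                  ≡⟨ *-distribˡ-+ (suc k !) (f (suc n)) _ ⟩
    suc k ! * f (suc n) + suc k ! * geo 1 f n          ≡⟨ cong₂ _+_ (*-assoc (suc k) (k !) _) (P-ones (suc k) n) ⟩
    suc k * (k ! * f (suc n)) + rising (suc k) n       ≡⟨ cong₂ _+_ (cong (suc k *_) (P-ones k (suc n))) (rising-suc k n) ⟩
    suc k * rising k (suc n) + suc n * rising k (suc n) ≡⟨ *-distribʳ-+ (rising k (suc n)) (suc k) (suc n) ⟨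
    (suc k + suc n) * rising k (suc n)                 ≡⟨ cong (_* rising k (suc n)) (+-comm (suc k) (suc n)) ⟩
    rising (suc k) (suc n)                             ∎
    where
    open ≡-Reasoning
    f = P (ones (suc k))

  rising-growth : ∀ k n → rising k n ≤ k ! * suc n ^ k
  rising-growth zero    n = ≤-refl
  rising-growth (suc k) n = begin
    (n + suc k) * rising k n                ≤⟨ *-mono-≤ lemma (rising-growth k n) ⟩
    (suc k * suc n) * (k ! * suc n ^ k)     ≡⟨ *.interchange (suc k) (suc n) (k !) _ ⟩
    (suc k * k !) * (suc n * suc n ^ k)     ∎
    where
    open ≤-Reasoning
    lemma : n + suc k ≤ suc k * suc n
    lemma = begin
      n + suc k           ≡⟨ +-suc n k ⟩
      suc n + k           ≤⟨ +-monoʳ-≤ (suc n) (m≤m*n k (suc n)) ⟩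
      suc n + k * suc n   ∎

  -- In the new factor `n + (2 + d)` only `n` matters; the constant contributes a multiple of
  -- `rising (suc d)`, which the error absorbs.
  rising-≈ : ∀ d → rising (suc d) ≈[ d ] (_^ suc d)
  rising-≈ zero    = ≈-trans
    (≗⇒≈ λ n → trans (*-identityʳ (n + 1)) (trans (+-comm n 1) (cong suc (sym (*-identityʳ n)))))
    (≈-small {f = λ _ → 1} 1 λ n → ≤-refl)
  rising-≈ (suc d) = ≈-trans
    (≗⇒≈ λ n → trans (*-distribʳ-+ (rising (suc d) n) n (2 + d)) (+-comm (n * rising (suc d) n) _))
    (≈-trans (≈-small {f = (2 + d) · rising (suc d)} ((2 + d) * suc d !) λ n →
      ≤-trans (*-monoʳ-≤ (2 + d) (rising-growth (suc d) n))
              (≤-reflexive (sym (*-assoc (2 + d) (suc d !) (suc n ^ suc d)))))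
    (≈-id· (rising-≈ d)))

  -- Asymptotics of the occurrences of one part

  occurrences-≈ : ∀ {d} L → length L ≡ suc d → foldr gcd 0 L ≡ 1 → All (0 <_) L →
                  ∀ {c} → c ∈ L →
                  (suc d ! * (c * product L)) · occurrences L c ≈[ d ] (_^ suc d)
  occurrences-≈ {d} L@(b ∷ M) refl gcd≡1 ps {c} c∈ =
    ≈-trans (≗⇒≈ λ n → *-assoc (suc d !) (c * product L) (occurrences L c n))
    (≈-trans (≈-· (suc d !) (≈-· (product (c ∷ L)) (period-geo c (P L) (P-growth b M))))
    (≈-trans (≈-· (suc d !) counted)
    (≈-trans (≗⇒≈ (P-ones (suc d))) (rising-≈ d))))
    where
    counted : product (c ∷ L) · P (c ∷ L) ≈[ d ] P (ones (2 + d))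
    -- The replacement starts from `j = 0`, where `ones j` is empty.
    counted = subst (λ M → product (c ∷ L) · P M ≈[ d ] P (ones (2 + d))) (++-identityʳ (c ∷ L))
      (P-≈-ones (c ∷ L) 0
        (cong length (++-identityʳ (c ∷ L)))
        (trans (cong (foldr gcd 0) (++-identityʳ (c ∷ L)))
                 (trans (cong (gcd c) gcd≡1) (gcd-zeroʳ c)))
        (All.lookup ps c∈ ∷ ps))

module RationalEstimates where

  open import Data.Integer.Base as ℤ using (+_; +≤+; +<+)
  import Data.Integer.Properties as ℤ
  import Data.Nat.Coprimality as Coprime
  open import Data.Rational.Base as ℚ hiding (NonZero)
  open import Data.Rational.Properties
  open import Data.Rational.Solver using (module +-*-Solver)
  import Algebra.Properties.CommutativeSemigroup ℕ.*-commutativeSemigroup as ℕ*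
  open +-*-Solver using (solve; _:+_; _:*_; _:-_; :-_; _:=_; con)

  open +-*-Solver using (solve; _:+_; _:*_; _:-_; :-_; _:=_; con)

  -- Natural numbers inside ℚ

  -- The reduced form of `fromℕ n`, which itself is stuck on a gcd for variable `n`.
  integer : ℕ → ℚ
  integer n = mkℚ (+ n) 0 (Coprime.sym (Coprime.1-coprimeTo n))

  fromℕ-integer : ∀ n → fromℕ n ≡ integer n
  fromℕ-integer n = normalize-coprime (Coprime.sym (Coprime.1-coprimeTo n))

  fromℕ-+ : ∀ m n → fromℕ (m ℕ.+ n) ≡ fromℕ m + fromℕ n
  fromℕ-+ m n = sym (trans (cong₂ _+_ (fromℕ-integer m) (fromℕ-integer n))
    (cong (_/ 1) (cong₂ ℤ._+_ (ℤ.*-identityʳ (+ m)) (ℤ.*-identityʳ (+ n)))))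

  fromℕ-* : ∀ m n → fromℕ (m ℕ.* n) ≡ fromℕ m * fromℕ n
  fromℕ-* m n = sym (trans (cong₂ _*_ (fromℕ-integer m) (fromℕ-integer n))
    (cong (_/ 1) (sym (ℤ.pos-* m n))))

  fromℕ-mono-≤ : ∀ {m n} → m ℕ.≤ n → fromℕ m ≤ fromℕ n
  fromℕ-mono-≤ {m} {n} m≤n = subst₂ _≤_ (sym (fromℕ-integer m)) (sym (fromℕ-integer n))
    (*≤* (ℤ.*-monoʳ-≤-nonNeg (+ 1) (+≤+ m≤n)))

  fromℕ-nonNeg : ∀ n → NonNegative (fromℕ n)
  fromℕ-nonNeg n = nonNegative (fromℕ-mono-≤ {0} {n} z≤n)

  fromℕ-pos : ∀ n .{{_ : NonZero n}} → Positive (fromℕ n)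
  fromℕ-pos n = normalize-pos n 1

  -- The absolute value of the numerator plus one suffices, as the denominator is at least 1.
  archimedean : ∀ q → ∃[ n ] q < fromℕ n
  archimedean q@(mkℚ i d _) = suc ℤ.∣ i ∣ , subst (q <_) (sym (fromℕ-integer (suc ℤ.∣ i ∣))) (*<* (begin-strict
    i ℤ.* + 1                        ≡⟨ ℤ.*-identityʳ i ⟩
    i                                ≤⟨ i≤∣i∣ i ⟩
    + ℤ.∣ i ∣                        <⟨ +<+ (ℕ.m≤m*n (suc ℤ.∣ i ∣) (suc d)) ⟩
    + suc ℤ.∣ i ∣ ℤ.* + suc d        ∎))
    where
    open ℤ.≤-Reasoning
    i≤∣i∣ : ∀ i → i ℤ.≤ + ℤ.∣ i ∣
    i≤∣i∣ (+ n)      = ℤ.≤-refl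
    i≤∣i∣ ℤ.-[1+ n ] = ℤ.-≤+

  archimedean-* : ∀ p q .{{_ : Positive q}} → ∃[ n ] p < q * fromℕ n
  archimedean-* p q =
    let n , p/q<n = archimedean (p ÷ q) in n , (begin-strict
      p                 ≡⟨ trans (*-assoc p (1/ q) q) (trans (cong (p *_) (*-inverseˡ q)) (*-identityʳ p)) ⟨
      p ÷ q * q         <⟨ *-monoˡ-<-pos q p/q<n ⟩
      fromℕ n * q       ≡⟨ *-comm (fromℕ n) q ⟩
      q * fromℕ n       ∎)
    where
    open ≤-Reasoning
    instance
      q≢0 : ℚ.NonZero q
      q≢0 = pos⇒nonZero q

  ∣p∣≤ : ∀ {p e} → p ≤ e → - p ≤ e → ∣ p ∣ ≤ e
  ∣p∣≤ {p} p≤e -p≤e with ∣p∣≡p∨∣p∣≡-p p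
  ... | inj₁ eq = ≤-trans (≤-reflexive eq) p≤e
  ... | inj₂ eq = ≤-trans (≤-reflexive eq) -p≤e

  p≤q+e⇒p-q≤e : ∀ {p q e} → p ≤ q + e → p - q ≤ e
  p≤q+e⇒p-q≤e {p} {q} {e} p≤ = begin
    p - q         ≤⟨ +-monoˡ-≤ (- q) p≤ ⟩
    q + e - q     ≡⟨ solve 2 (λ q e → q :+ e :- q := e) refl q e ⟩
    e             ∎
    where open ≤-Reasoning

  fromℕ-distance : ∀ {m n e} → ℕ.∣ m - n ∣ ℕ.≤ e → ∣ fromℕ m - fromℕ n ∣ ≤ fromℕ e
  fromℕ-distance {m} {n} {e} ≤e = ∣p∣≤
    (p≤q+e⇒p-q≤e (bound m n (ℕ.≤-trans (ℕ.m≤n+∣m-n∣ m n) (ℕ.+-monoʳ-≤ n ≤e))))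
    (≤-trans (≤-reflexive (solve 2 (λ m n → :- (m :- n) := n :- m) refl (fromℕ m) (fromℕ n)))
      (p≤q+e⇒p-q≤e (bound n m (ℕ.≤-trans (ℕ.m≤n+∣n-m∣ n m) (ℕ.+-monoʳ-≤ m ≤e)))))
    where
    bound : ∀ m n → m ℕ.≤ n ℕ.+ e → fromℕ m ≤ fromℕ n + fromℕ e
    bound m n m≤ = ≤-trans (fromℕ-mono-≤ m≤) (≤-reflexive (fromℕ-+ n e))

  1/ℕ-* : ∀ n (n≢0 : NonZero n) → 1/ℕ n n≢0 * fromℕ n ≡ 1ℚ
  1/ℕ-* (suc n) _ = trans
    (cong₂ _*_ (normalize-coprime (Coprime.1-coprimeTo (suc n))) (fromℕ-integer (suc n)))
    (*-inverseˡ (integer (suc n)))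

  1/ℕ-pos : ∀ n (n≢0 : NonZero n) → Positive (1/ℕ n n≢0)
  1/ℕ-pos n n≢0 = normalize-pos 1 n {{n≢0}}

  -- Linear estimates and their sums

  -- This is x = r y + O(z), with a bound valid for every `n`.
  Estimate : (x : ℕ → ℚ) (r : ℚ) (y z : ℕ → ℚ) → Set
  Estimate x r y z = ∃[ C ] ∀ n → ∣ x n - r * y n ∣ ≤ C * z n

  estimate-∑ : ∀ {k} {x : Fin k → ℕ → ℚ} {r y z} → (∀ i → Estimate (x i) (r i) y z) →
               Estimate (λ n → ∑ (λ i → x i n)) (∑ r) y z
  estimate-∑ {zero} {y = y} {z} e = 0ℚ , λ n → ≤-reflexive (trans
    (cong ∣_∣ (solve 1 (λ y → con 0ℚ :- con 0ℚ :* y := con 0ℚ) refl (y n)))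
    (sym (*-zeroˡ (z n))))
  estimate-∑ {suc k} {x} {r} {y} {z} e
    with (C , p) ← e zero | (D , q) ← estimate-∑ (e ∘ suc) = C + D , λ n →
    let x₀ = x zero n; r₀ = r zero; X = ∑ (λ i → x (suc i) n); R = ∑ (r ∘ suc) in begin
    ∣ x₀ + X - (r₀ + R) * y n ∣                   ≡⟨ cong ∣_∣ (solve 5 (λ x₀ X r₀ R y →
      x₀ :+ X :- (r₀ :+ R) :* y := (x₀ :- r₀ :* y) :+ (X :- R :* y)) refl x₀ X r₀ R (y n)) ⟩
    ∣ (x₀ - r₀ * y n) + (X - R * y n) ∣           ≤⟨ ∣p+q∣≤∣p∣+∣q∣ (x₀ - r₀ * y n) (X - R * y n) ⟩
    ∣ x₀ - r₀ * y n ∣ + ∣ X - R * y n ∣           ≤⟨ +-mono-≤ (p n) (q n) ⟩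
    C * z n + D * z n                             ≡⟨ *-distribʳ-+ (z n) C D ⟨
    (C + D) * z n                                 ∎
    where open ≤-Reasoning

  ∑-fromℕ : ∀ {k} W (X : Vector ℕ k) → ∑ (λ i → W * fromℕ (X i)) ≡ W * fromℕ (sum (tabulate X))
  ∑-fromℕ {zero}  W X = sym (*-zeroʳ W)
  ∑-fromℕ {suc k} W X = begin
    W * fromℕ (X zero) + ∑ (λ i → W * fromℕ (X (suc i)))
      ≡⟨ cong (λ S → W * fromℕ (X zero) + S) (∑-fromℕ W (X ∘ suc)) ⟩
    W * fromℕ (X zero) + W * fromℕ (sum (tabulate (X ∘ suc)))
      ≡⟨ *-distribˡ-+ W (fromℕ (X zero)) _ ⟨
    W * (fromℕ (X zero) + fromℕ (sum (tabulate (X ∘ suc))))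
      ≡⟨ cong (W *_) (fromℕ-+ (X zero) _) ⟨
    W * fromℕ (sum (tabulate X)) ∎
    where open ≡-Reasoning

  ∑-nonNeg : ∀ {k} (r : Vector ℚ k) → (∀ i → Positive (r i)) → NonNegative (∑ r)
  ∑-nonNeg {zero}  r p = _
  ∑-nonNeg {suc k} r p = nonNeg+nonNeg⇒nonNeg (r zero) {{pos⇒nonNeg (r zero) {{p zero}}}}
    (∑ (r ∘ suc)) {{∑-nonNeg (r ∘ suc) (p ∘ suc)}}

  ∑-pos : ∀ {k} (r : Vector ℚ (suc k)) → (∀ i → Positive (r i)) → Positive (∑ r)
  ∑-pos r p = pos+nonNeg⇒pos (r zero) {{p zero}} (∑ (r ∘ suc)) {{∑-nonNeg (r ∘ suc) (p ∘ suc)}}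

  -- From an estimate to asymptotic equivalence

  -- Compares the error scale `suc m ^ d` with `m ^ d` at m = n + 1, using n + 2 ≤ 2(n + 1).
  suc^≤ : ∀ d n → suc (suc n) ℕ.^ d ℕ.≤ 2 ℕ.^ d ℕ.* suc n ℕ.^ d
  suc^≤ zero    n = ℕ.≤-refl
  suc^≤ (suc d) n = begin
    suc (suc n) ℕ.* suc (suc n) ℕ.^ d              ≤⟨ ℕ.*-mono-≤ lemma (suc^≤ d n) ⟩
    2 ℕ.* suc n ℕ.* (2 ℕ.^ d ℕ.* suc n ℕ.^ d)      ≡⟨ ℕ*.interchange 2 (suc n) (2 ℕ.^ d) _ ⟩
    2 ℕ.^ suc d ℕ.* suc n ℕ.^ suc d                ∎
    where
    open ℕ.≤-Reasoning
    lemma : suc (suc n) ℕ.≤ 2 ℕ.* suc n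
    lemma = s≤s (ℕ.≤-trans (s≤s (ℕ.m≤m+n n 0)) (ℕ.m≤n+m (suc (n ℕ.+ 0)) n))

  p≤∣p∣ : ∀ p → p ≤ ∣ p ∣
  p≤∣p∣ p with ≤-total 0ℚ p
  ... | inj₁ 0≤p = ≤-reflexive (sym (0≤p⇒∣p∣≡p 0≤p))
  ... | inj₂ p≤0 = ≤-trans p≤0 (0≤∣p∣ p)

  -- Multiplication by `t` clears the denominator: (f/g - 1) t = W f - t. Since `t` is positive, `g`
  -- is nonzero and `t` cancels from the inequality.
  quotient-close : ∀ {f g ε} W t .{{_ : Positive t}} → W * g ≡ t → ∣ W * f - t ∣ < ε * t →
                   Σ[ g≢0 ∈ ℚ.NonZero g ] ∣ (f ÷ g) {{g≢0}} - 1ℚ ∣ < ε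
  quotient-close {f} {g} {ε} W t W*g≡t error =
    g≢0 , *-cancelʳ-<-nonNeg t {{pos⇒nonNeg t}} (begin-strict
      ∣ q - 1ℚ ∣ * t          ≡⟨ cong (∣ q - 1ℚ ∣ *_) (0≤p⇒∣p∣≡p (<⇒≤ (positive⁻¹ t))) ⟨
      ∣ q - 1ℚ ∣ * ∣ t ∣      ≡⟨ ∣p*q∣≡∣p∣*∣q∣ (q - 1ℚ) t ⟨
      ∣ (q - 1ℚ) * t ∣        ≡⟨ cong ∣_∣ scaled ⟩
      ∣ W * f - t ∣           <⟨ error ⟩
      ε * t                   ∎)
    where
    open ≤-Reasoning
    g≢0 : ℚ.NonZero g
    g≢0 = ≢-nonZero λ g≡0 → <-irrefl
      (sym (trans (sym W*g≡t) (trans (cong (W *_) g≡0) (*-zeroʳ W))))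
      (positive⁻¹ t)

    u q : ℚ
    u = (1/ g) {{g≢0}}
    q = f * u

    scaled : (q - 1ℚ) * t ≡ W * f - t
    scaled = begin-equality
      (f * u - 1ℚ) * t                  ≡⟨ cong ((f * u - 1ℚ) *_) W*g≡t ⟨
      (f * u - 1ℚ) * (W * g)            ≡⟨ solve 4 (λ f u W g →
        (f :* u :- con 1ℚ) :* (W :* g) := W :* f :* (u :* g) :- W :* g) refl f u W g ⟩
      W * f * (u * g) - W * g           ≡⟨ cong₂ (λ a b → W * f * a - b) (*-inverseˡ g {{g≢0}}) W*g≡t ⟩
      W * f * 1ℚ - t                    ≡⟨ cong (λ a → a - t) (*-identityʳ (W * f)) ⟩
      W * f - t                         ∎

  -- The main term has one factor `m` more than the error; `N` is so large that this factor
  -- outweighs the constant. The sign of `C` is unknown, hence `∣ C ∣`.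
  error-small : ∀ C {z b w ε s N m} .{{_ : NonNegative z}} .{{_ : Positive w}} .{{_ : Positive (ε * s)}} →
                z ≤ b * w → ∣ C ∣ * b < ε * s * N → N ≤ m → C * z < ε * (s * (m * w))
  error-small C {z} {b} {w} {ε} {s} {N} {m} z≤bw large N≤m = begin-strict
    C * z               ≤⟨ *-monoʳ-≤-nonNeg z (p≤∣p∣ C) ⟩
    ∣ C ∣ * z           ≤⟨ *-monoˡ-≤-nonNeg ∣ C ∣ {{∣-∣-nonNeg C}} z≤bw ⟩
    ∣ C ∣ * (b * w)     ≡⟨ *-assoc ∣ C ∣ b w ⟨
    ∣ C ∣ * b * w       <⟨ *-monoˡ-<-pos w large ⟩
    ε * s * N * w       ≤⟨ *-monoʳ-≤-nonNeg w {{pos⇒nonNeg w}}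
                             (*-monoˡ-≤-nonNeg (ε * s) {{pos⇒nonNeg (ε * s)}} N≤m) ⟩
    ε * s * m * w       ≡⟨ solve 4 (λ ε s m w → ε :* s :* m :* w := ε :* (s :* (m :* w))) refl ε s m w ⟩
    ε * (s * (m * w))   ∎
    where open ≤-Reasoning

  estimate⇒∼ : ∀ d {f g : ℕ → ℚ} W s → Positive s →
    Estimate (λ n → W * f n) s (λ n → fromℕ (n ℕ.^ suc d)) (λ n → fromℕ (suc n ℕ.^ d)) →
    (∀ n → W * g n ≡ s * fromℕ (n ℕ.^ suc d)) → f ∼ g
  -- The threshold `suc N` keeps the argument positive, and with it the main term.
  estimate⇒∼ d {f} {g} W s s>0 (C , est) W*g ε ε>0 = suc N , λ { (suc n) (s≤s N≤n) → close n N≤n }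
    where
    εs>0 : Positive (ε * s)
    εs>0 = pos*pos⇒pos ε {{positive ε>0}} s {{s>0}}

    archimedes : ∃[ N ] ∣ C ∣ * fromℕ (2 ℕ.^ d) < ε * s * fromℕ N
    archimedes = archimedean-* (∣ C ∣ * fromℕ (2 ℕ.^ d)) (ε * s) {{εs>0}}

    N = proj₁ archimedes

    close : ∀ n → N ℕ.≤ n → Σ[ g≢0 ∈ ℚ.NonZero (g (suc n)) ] ∣ (f (suc n) ÷ g (suc n)) {{g≢0}} - 1ℚ ∣ < ε
    close n N≤n = quotient-close W (s * y) {{sy>0}} (W*g m) (≤-<-trans (est m) (begin-strict
      C * fromℕ (suc m ℕ.^ d)
        <⟨ error-small C {ε = ε} {s} {{fromℕ-nonNeg (suc m ℕ.^ d)}} {{fromℕ-pos (m ℕ.^ d) {{ℕ.m^n≢0 m d}}}} {{εs>0}}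
             (≤-trans (fromℕ-mono-≤ (suc^≤ d n)) (≤-reflexive (fromℕ-* (2 ℕ.^ d) (m ℕ.^ d))))
             (proj₂ archimedes) (fromℕ-mono-≤ (ℕ.m≤n⇒m≤1+n N≤n)) ⟩
      ε * (s * (fromℕ m * fromℕ (m ℕ.^ d)))
        ≡⟨ cong (λ a → ε * (s * a)) (fromℕ-* m (m ℕ.^ d)) ⟨
      ε * (s * y) ∎))
      where
      open ≤-Reasoning
      m = suc n
      y = fromℕ (m ℕ.^ suc d)
      sy>0 : Positive (s * y)
      sy>0 = pos*pos⇒pos s {{s>0}} y {{fromℕ-pos (m ℕ.^ suc d) {{ℕ.m^n≢0 m (suc d)}}}}

open PartitionCounts
open RationalEstimates

open import Data.Nat.Base using (ℕ; NonZero; _^_; _!)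
open import Data.Nat.Properties using (_!≢0)
open import Data.Rational.Base using (_*_)
open import Data.Vec.Functional using (Vector)
open import Function.Definitions using (Injective)
open import Relation.Binary.PropositionalEquality using (_≡_)

open import Data.Rational.Base as ℚ using (ℚ; _-_; _≤_; ∣_∣; 1ℚ; 1/_)
import Data.Rational.Properties as ℚ
open import Data.Rational.Solver using (module +-*-Solver)
open +-*-Solver using (solve; _:*_; _:-_; _:=_)
open import Data.List.Sort (Flip.decTotalOrder ℕ.≤-decTotalOrder) using (sort; sort-↭; sort-↗)

-- The number of parts as a sum of occurrences

-- Sorting is for the reversed order, hence weakly decreasing; distinct entries make the decrease
-- strict, as the results on `enum` require.
sort-decreasing : ∀ {L} → Unique L → AllPairs ℕ._>_ (sort L)
sort-decreasing {L} u = AllPairs.zipWith (λ (x≥y , x≢y) → ℕ.≤∧≢⇒< x≥y (x≢y ∘ sym))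
  ( Linked⇒AllPairs (λ x≥y y≥z → ℕ.≤-trans y≥z x≥y) (sort-↗ L)
  , ↭ₛ.Unique-resp-↭ (setoid ℕ) (↭⇒↭ₛ (↭-sym (sort-↭ L))) u)

total-↭ : ∀ F {L M} → L ↭ M → total F L ≗ total F M
total-↭ F p n = sum-↭ (↭.map⁺ (λ c → F c n) p)

-- The vector comes in any order, so the enumeration runs over its sorted list; `P` and `total` are
-- invariant under permutation, which leads back to `a`.
Nᵖ≡occurrences : ∀ {k} (a : Vector ℕ k) → (∀ i → NonZero (a i)) → Injective _≡_ _≡_ a →
  ∀ n → Nᵖ ⟦ a ⟧? n ≡ sum (tabulate (λ i → occurrences (tabulate a) (a i) n))
Nᵖ≡occurrences a a≢0 inj n = begin
  totalLength (partitions ⟦ a ⟧? n)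
    ≡⟨ sum-↭ (↭.map⁺ _ (enum-↭-partitions ⟦ a ⟧? positive (sort-decreasing (Unique.tabulate⁺ inj)) A⇒L L⇒A n)) ⟩
  totalLength (enum L n)
    ≡⟨ enum-totalLength L n ⟩
  total (occurrences L) L n
    ≡⟨ total-cong L (λ c → ≫-cong (step c) (geo-cong c (P-↭ L↭))) n ⟩
  total (occurrences (tabulate a)) L n
    ≡⟨ total-↭ (occurrences (tabulate a)) L↭ n ⟩
  total (occurrences (tabulate a)) (tabulate a) n
    ≡⟨ cong sum (map-tabulate a (λ c → occurrences (tabulate a) c n)) ⟩
  sum (tabulate (λ i → occurrences (tabulate a) (a i) n)) ∎
  where
  open ≡-Reasoning
  L = sort (tabulate a)

  L↭ : L ↭ tabulate a
  L↭ = sort-↭ (tabulate a)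

  positive : All (0 ℕ.<_) L
  positive = ↭.All-resp-↭ (↭-sym L↭) (All.tabulate⁺ (λ i → ℕ.>-nonZero⁻¹ (a i) {{a≢0 i}}))

  A⇒L : ∀ {x} → ⟦ a ⟧ x → x ∈ L
  A⇒L (i , refl) = ↭.∈-resp-↭ (↭-sym L↭) (∈-tabulate⁺ i)

  L⇒A : ∀ {x} → x ∈ L → ⟦ a ⟧ x
  L⇒A x∈ with i , eq ← ∈-tabulate⁻ (↭.∈-resp-↭ L↭ x∈) = i , sym eq

-- Weighted estimates and the conclusion

gcds≡foldr : ∀ {k} (a : Vector ℕ k) → gcds a ≡ foldr gcd 0 (tabulate a)
gcds≡foldr {zero}  a = refl
gcds≡foldr {suc k} a = cong (gcd (a zero)) (gcds≡foldr (a ∘ suc))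

∏≡product : ∀ {k} (a : Vector ℕ k) → ∏ a ≡ product (tabulate a)
∏≡product {zero}  a = refl
∏≡product {suc k} a = cong (a zero ℕ.*_) (∏≡product (a ∘ suc))

-- With `r` the reciprocal of `c`, turns an error of `c * (W * x)` against `y` into one of `W * x`
-- against `r * y`.
rescale : ∀ {W r c x y : ℚ} → r * c ≡ 1ℚ → W * x - r * y ≡ r * (c * (W * x) - y)
rescale {W} {r} {c} {x} {y} rc≡1 = begin
  W * x - r * y                 ≡⟨ cong (λ p → p - r * y) (ℚ.*-identityˡ (W * x)) ⟨
  1ℚ * (W * x) - r * y          ≡⟨ cong (λ p → p * (W * x) - r * y) rc≡1 ⟨
  r * c * (W * x) - r * y       ≡⟨ solve 4 (λ r c v y → r :* c :* v :- r :* y := r :* (c :* v :- y)) refl r c (W * x) y ⟩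
  r * (c * (W * x) - y)         ∎
  where
  open ≡-Reasoning

weight : ℕ → ℕ → ℚ
weight k p = fromℕ (k !) * fromℕ p

weighted-occurrences : ∀ k c p X → fromℕ (k ! ℕ.* (c ℕ.* p) ℕ.* X) ≡ fromℕ c * (weight k p * fromℕ X)
weighted-occurrences k c p X = begin
  fromℕ (k ! ℕ.* (c ℕ.* p) ℕ.* X)
    ≡⟨ trans (fromℕ-* (k ! ℕ.* (c ℕ.* p)) X) (cong (_* fromℕ X) (trans (fromℕ-* (k !) (c ℕ.* p)) (cong (fromℕ (k !) *_) (fromℕ-* c p)))) ⟩
  fromℕ (k !) * (fromℕ c * fromℕ p) * fromℕ X
    ≡⟨ lemma (fromℕ (k !)) (fromℕ c) (fromℕ p) (fromℕ X) ⟩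
  fromℕ c * (weight k p * fromℕ X) ∎
  where
  open ≡-Reasoning
  lemma : ∀ w c p x → w * (c * p) * x ≡ c * (w * p * x)
  lemma = solve 4 (λ w c p x → w :* (c :* p) :* x := c :* (w :* p :* x)) refl

-- Only `c` is divided out. The weight k! a₁⋯aₖ is the same for all parts, so the estimates can be
-- added, and the coefficients 1/c add up to the sum of reciprocals.
occurrences-estimate : ∀ {d} L {c} (c≢0 : NonZero c) →
  ((suc d ! ℕ.* (c ℕ.* product L)) · occurrences L c ≈[ d ] (_^ suc d)) →
  Estimate (λ n → weight (suc d) (product L) * fromℕ (occurrences L c n)) (1/ℕ c c≢0)
           (λ n → fromℕ (n ^ suc d)) (λ n → fromℕ (suc n ^ d))
occurrences-estimate {d} L {c} c≢0 (within C p) = r * fromℕ C , λ n →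
  let x = occurrences L c n; y = fromℕ (n ^ suc d) in begin
  ∣ W * fromℕ x - r * y ∣                     ≡⟨ cong ∣_∣ (rescale {W} {r} {fromℕ c} {fromℕ x} {y} (1/ℕ-* c c≢0)) ⟩
  ∣ r * (fromℕ c * (W * fromℕ x) - y) ∣       ≡⟨ ℚ.∣p*q∣≡∣p∣*∣q∣ r (fromℕ c * (W * fromℕ x) - y) ⟩
  ∣ r ∣ * ∣ fromℕ c * (W * fromℕ x) - y ∣     ≡⟨ cong₂ (λ s t → s * ∣ t - y ∣) (ℚ.0≤p⇒∣p∣≡p (ℚ.nonNegative⁻¹ r {{r≥0}}))
                                                   (sym (weighted-occurrences (suc d) c (product L) x)) ⟩
  r * ∣ fromℕ (suc d ! ℕ.* (c ℕ.* product L) ℕ.* x) - y ∣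
    ≤⟨ ℚ.*-monoˡ-≤-nonNeg r {{r≥0}} (fromℕ-distance {suc d ! ℕ.* (c ℕ.* product L) ℕ.* x} {n ^ suc d} (p n)) ⟩
  r * fromℕ (C ℕ.* suc n ^ d)                 ≡⟨ cong (r *_) (fromℕ-* C (suc n ^ d)) ⟩
  r * (fromℕ C * fromℕ (suc n ^ d))           ≡⟨ ℚ.*-assoc r (fromℕ C) _ ⟨
  r * fromℕ C * fromℕ (suc n ^ d)             ∎
  where
  open ℚ.≤-Reasoning
  r = 1/ℕ c c≢0
  W = weight (suc d) (product L)
  r≥0 : ℚ.NonNegative r
  r≥0 = ℚ.pos⇒nonNeg r {{1/ℕ-pos c c≢0}}

weighted-main-term : ∀ {w p v s u y : ℚ} → v * w ≡ 1ℚ → u * p ≡ 1ℚ →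
                     w * p * (v * (s * u) * y) ≡ s * y
weighted-main-term {w} {p} {v} {s} {u} {y} vw≡1 up≡1 = begin
  w * p * (v * (s * u) * y)       ≡⟨ solve 6 (λ w p v s u y →
    w :* p :* (v :* (s :* u) :* y) := (v :* w) :* (u :* p) :* (s :* y)) refl w p v s u y ⟩
  (v * w) * (u * p) * (s * y)     ≡⟨ cong₂ (λ a b → a * b * (s * y)) vw≡1 up≡1 ⟩
  1ℚ * (s * y)                    ≡⟨ ℚ.*-identityˡ (s * y) ⟩
  s * y                           ∎
  where
  open ≡-Reasoning

theorem8 : ∀ (k : ℕ) (a : Vector ℕ k) (a≢0 : ∀ i → NonZero (a i)) →
    Injective _≡_ _≡_ a →
    gcds a ≡ 1 →
    (λ n → fromℕ (Nᵖ ⟦ a ⟧? n)) ∼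
    (λ n → 1/ℕ (k !) (k !≢0) * (∑ (λ i → 1/ℕ (a i) (a≢0 i)) ÷ℕ ∏ a [ ∏-nonZero a a≢0 ]) * fromℕ (n ^ k))
-- For `k = 0` the gcd is 0, which contradicts the hypothesis, so only positive `k` remains.
theorem8 (suc d) a a≢0 inj gcd≡1 = estimate⇒∼ d W s
  (∑-pos (λ i → 1/ℕ (a i) (a≢0 i)) (λ i → 1/ℕ-pos (a i) (a≢0 i)))
  (constant , λ n → subst (λ x → ∣ x - s * fromℕ (n ^ suc d) ∣ ≤ constant * fromℕ (suc n ^ d))
    (trans (∑-fromℕ W (λ i → occurrences L (a i) n))
           (cong (λ N → W * fromℕ N) (sym (Nᵖ≡occurrences a a≢0 inj n))))
    (within-constant n))
  (λ n → subst (λ p → weight (suc d) p * (1/ℕ (suc d !) (suc d !≢0) * (s ÷ℕ ∏ a [ ∏≢0 ]) * fromℕ (n ^ suc d)) ≡ s * fromℕ (n ^ suc d))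
    (∏≡product a)
    (weighted-main-term {fromℕ (suc d !)} {fromℕ (∏ a)} {1/ℕ (suc d !) (suc d !≢0)} {s}
      {(1/ fromℕ (∏ a)) {{fromℕ-nonZero (∏ a) ∏≢0}}} {fromℕ (n ^ suc d)} (1/ℕ-* (suc d !) (suc d !≢0))
      (ℚ.*-inverseˡ (fromℕ (∏ a)) {{fromℕ-nonZero (∏ a) ∏≢0}})))
  where
  L = tabulate a
  W = weight (suc d) (product L)
  s = ∑ (λ i → 1/ℕ (a i) (a≢0 i))
  ∏≢0 = ∏-nonZero a a≢0

  estimate : Estimate (λ n → ∑ (λ i → W * fromℕ (occurrences L (a i) n))) s
                      (λ n → fromℕ (n ^ suc d)) (λ n → fromℕ (suc n ^ d))
  estimate = estimate-∑ {x = λ i n → W * fromℕ (occurrences L (a i) n)} {λ i → 1/ℕ (a i) (a≢0 i)}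
    {λ n → fromℕ (n ^ suc d)} {λ n → fromℕ (suc n ^ d)} λ i → occurrences-estimate L (a≢0 i)
    (occurrences-≈ L (length-tabulate a) (trans (sym (gcds≡foldr a)) gcd≡1)
      (All.tabulate⁺ (λ i → ℕ.>-nonZero⁻¹ (a i) {{a≢0 i}})) (∈-tabulate⁺ {f = a} i))

  constant = proj₁ estimate
  within-constant = proj₂ estimate
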